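{- Let $G$ be a weighted planar graph with $n$ vertices and bounded vertex degree, let $k=\lceil n^{1/2}\rceil$, and suppose that the preprocessing data structure described in the context has been computed for a $k$-partition of $G$. Then, for any vertices $v_1,v_2$ of $G$, the query algorithm (described in the context) correctly computes $\mathrm{dist}(v_1,v_2)$, and with $p\ge\lceil n^{1/4}\rceil$ processors its running time is $O(n^{1/4})$.
   Context: Graphs are finite, with a nonnegative weight $\mathrm{wt}(e)$ on each edge $e$. Bounded vertex degree means that the degree is $O(1)$ as a function of $n$. The length of a path is the sum of the weights of its edges. $\mathrm{dist}(v,w)$ is the minimum length of a path between $v$ and $w$ in $G$, and $\mathrm{dist}_H(v,w)$ is the corresponding distance in a graph $H$ ($\infty$ if there is no path). A $k$-partition $\mathcal P$ of $G$ is a collection $V_1,\dots,V_k$ of pairwise disjoint subsets of $V(G)$ whose union is $V(G)$. The subgraphs of $G$ induced by the $V_i$ are the components of $\mathcal P$. A boundary vertex is a vertex with at least one neighbor in a different component, and $B(C)$ is the set of boundary vertices lying in the component $C$. The partition used is one in which each component $C$ has $O(n/k)$ vertices and $|B(C)|=O(\sqrt{n/k})$ (such a partition exists for planar graphs of bounded degree). Boundary graph $\mathit{BG}$: its vertices are all boundary vertices of $G$; its edges are the edges of $G$ between boundary vertices, together with, for every component $C$ and every pair $v,w\in B(C)$, an edge $(v,w)$ (if not already in $G$); for such pairs $v,w\in B(C)$ the weight is set to $\mathrm{wt}(v,w)=\mathrm{dist}_C(v,w)$, while edges of $G$ joining different components keep their weights. Preprocessing data structure: for each component $C$, a table $\mathrm{APSP}(C)$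 containing $\mathrm{dist}_C(v,w)$ for all $v,w\in C$, and a table $\mathrm{APSP}_{\mathit{BG}}(C)$ containing $\mathrm{dist}_{\mathit{BG}}(b,b')$ for all $b\in B(C)$ and all vertices $b'$ of $\mathit{BG}$; both are stored at the node $N(C)$ to which $C$ is assigned. The component containing a given vertex, and any table entry, can be looked up in $O(1)$ time. Query algorithm (input: vertices $v_1,v_2$ of $G$, the partition $\mathcal P$, and the tables above): 1. Determine the components $C_1,C_2$ with $v_1\in C_1$, $v_2\in C_2$. 2. For all $b_2\in B(C_2)$ in parallel: set $d(v_1,b_2)=\infty$; then for all $b_1\in B(C_1)$ (sequentially) set $d(v_1,b_2)=\min\{d(v_1,b_2),\ \mathrm{dist}_{C_1}(v_1,b_1)+\mathrm{dist}_{\mathit{BG}}(b_1,b_2)\}$. 3. If $N(C_1)\ne N(C_2)$, transfer the column of $\mathrm{APSP}(C_2)$ corresponding to $v_2$ from $N(C_2)$ to $N(C_1)$. 4. Set $d(v_1,v_2)=\infty$; for all $b_2\in B(C_2)$ (sequentially) set $d(v_1,v_2)=\min\{d(v_1,v_2),\ d(v_1,b_2)+\mathrm{dist}_{C_2}(b_2,v_2)\}$. 5. If $C_1=C_2$, set $d(v_1,v_2)=\min\{d(v_1,v_2),\ \mathrm{dist}_{C_1}(v_1,v_2)\}$, where $\mathrm{dist}_{C_1}(v_1,v_2)$ is taken from $\mathrm{APSP}(C_1)$. The output is the final value $d(v_1,v_2)$; "correctly computes" means that it equals $\mathrm{dist}(v_1,v_2)$. Running time is parallel computation time in which the iterations of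 the parallel loop in step 2 are distributed evenly over the $p$ processors; no time is charged for data transfer between nodes. -}

module Defs where

open import Algebra.Structures using (IsCommutativeMonoid)
import Algebra.Construct.NaturalChoice.Min as Min
open import Data.Bool.Base using (if_then_else_)
open import Data.Fin.Base as Fin using (Fin)
open import Data.Fin.Properties using (_≟_; any?)
open import Data.List.Base
  using (List; []; _∷_; [_]; _++_; map; foldr; filter; length; lookup;
         head; last; allFin; cartesianProductWith)
open import Data.List.Relation.Unary.All using (All; all?)
open import Data.List.Relation.Unary.Linked using (Linked; linked?)
open import Data.List.Relation.Unary.Unique.Propositional using (Unique)
import Data.List.Relation.Unary.Unique.DecPropositional as DecUnique
open import Data.Maybe.Base using (just)
import Data.Maybe.Properties as Maybe
open import Data.Nat.Base using (ℕ; zero; suc; pred; _+_; _*_; _^_; _⊔_; _≤_; NonZero)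
open import Data.Nat.DivMod using (_/_)
open import Data.Nat.ListAction using (sum)
open import Data.Product.Base using (_×_; _,_; ∃; proj₁; proj₂)
open import Data.Rational.Base as ℚ using (ℚ; 0ℚ; 1ℚ)
open import Data.Sum.Base using (_⊎_; inj₁; inj₂)
import Data.Sum.Base as Sum
open import Function.Bundles using (_⇔_; module Equivalence)
open import Level as L using (0ℓ)
open import Relation.Binary.Bundles using (TotalOrder)
open import Relation.Binary.Core using (Rel; _Preserves₂_⟶_⟶_)
import Relation.Binary.Definitions as B
open import Relation.Binary.PropositionalEquality.Core using (_≡_; _≢_; refl; sym; subst)
import Relation.Binary.Construct.Add.Supremum.Equality as Supremum≈
import Relation.Binary.Construct.Add.Supremum.NonStrict as Supremum≤
open import Relation.Nullary.Construct.Add.Supremum as Sup using (_⁺; ⊤⁺)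
open import Relation.Nullary.Decidable.Core using (Dec; yes; no; does; _×-dec_; _⊎-dec_)
open import Relation.Nullary.Decidable using (¬?)
open import Relation.Nullary.Negation.Core using (¬_)
open import Relation.Unary using (Pred; Decidable)

card : ∀ {N} {P : Pred (Fin N) 0ℓ} → Decidable P → ℕ
card P? = length (filter P? (allFin _))

-- m = ⌈ n^(1/r) ⌉, for r ≥ 1.
IsCeilRoot : (r n m : ℕ) → Set
IsCeilRoot r n m = n ≤ m ^ r × (∀ j → n ≤ j ^ r → m ≤ j)

⌈_/_⌉ : (m p : ℕ) .{{_ : NonZero p}} → ℕ
⌈ m / p ⌉ = (m + pred p) / p

------------------------------------------------------------------------
-- Finite simple graphs

-- The vertex set is an arbitrary subset of Fin N, so that subgraphs and
-- boundary graphs of a graph can share its vertices.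
record Graph (N : ℕ) : Set₁ where
  infix 4 _~_ _~?_
  field
    Vertex   : Pred (Fin N) 0ℓ
    vertex?  : Decidable Vertex
    _~_      : Rel (Fin N) 0ℓ
    _~?_     : B.Decidable _~_
    ~-sym    : ∀ {u v} → u ~ v → v ~ u
    ~-irrefl : ∀ {v} → ¬ (v ~ v)
    ~-vertex : ∀ {u v} → u ~ v → Vertex u

  order : ℕ
  order = card vertex?

  degree : Fin N → ℕ
  degree v = card (v ~?_)

induced : ∀ {N} → Graph N → {S : Pred (Fin N) 0ℓ} → Decidable S → Graph N
induced G {S} S? = record
  { Vertex   = λ v → Vertex v × S v
  ; vertex?  = λ v → vertex? v ×-dec S? v
  ; _~_      = λ u v → u ~ v × S u × S v
  ; _~?_     = λ u v → (u ~? v) ×-dec (S? u ×-dec S? v)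
  ; ~-sym    = λ (e , su , sv) → ~-sym e , sv , su
  ; ~-irrefl = λ (e , _) → ~-irrefl e
  ; ~-vertex = λ (e , su , _) → ~-vertex e , su
  }
  where open Graph G

module _ {N} (H : Graph N) where
  open Graph H

  IsPath : (u v : Fin N) → Pred (List (Fin N)) 0ℓ
  IsPath u v xs =
    head xs ≡ just u × last xs ≡ just v × All Vertex xs × Linked _~_ xs × Unique xs

  isPath? : ∀ u v → Decidable (IsPath u v)
  isPath? u v xs =
    Maybe.≡-dec _≟_ (head xs) (just u) ×-dec
    (Maybe.≡-dec _≟_ (last xs) (just v) ×-dec
    (all? vertex? xs ×-dec
    (linked? _~?_ xs ×-dec
     DecUnique.unique? _≟_ xs)))

sequences : ∀ N → ℕ → List (List (Fin N))
sequences N zero    = [ [] ]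
sequences N (suc m) = [] ∷ cartesianProductWith _∷_ (allFin N) (sequences N m)

-- A path does not repeat vertices, so it has at most N of them.
paths : ∀ {N} → Graph N → (u v : Fin N) → List (List (Fin N))
paths {N} H u v = filter (isPath? H u v) (sequences N N)

------------------------------------------------------------------------
-- Planarity

Point : Set
Point = ℚ × ℚ

between : Point → Point → ℚ → Point
between (x , y) (x′ , y′) t =
  x ℚ.+ t ℚ.* (x′ ℚ.- x) , y ℚ.+ t ℚ.* (y′ ℚ.- y)

-- The i-th segment (from 0) of a polygonal curve with the given corners
-- is traversed during the parameter interval [ i , i + 1 ].
data _∋_at_ : List Point → Point → ℚ → Set where
  here  : ∀ {P Q ps t} → 0ℚ ℚ.≤ t → t ℚ.≤ 1ℚ → (P ∷ Q ∷ ps) ∋ between P Q t at t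
  there : ∀ {P ps R t} → ps ∋ R at t → (P ∷ ps) ∋ R at (1ℚ ℚ.+ t)

-- A drawing in the plane without crossings, edges being drawn as polygonal
-- arcs.  Restricting to rational corners loses no planar graph: the corners
-- of a crossing-free polygonal drawing can be perturbed.
record Planar {N} (G : Graph N) : Set where
  open Graph G

  Edge : Rel (Fin N) 0ℓ
  Edge u v = u ~ v × u Fin.< v

  field
    position : Fin N → Point
    bends    : Fin N → Fin N → List Point

  arc : Fin N → Fin N → List Point
  arc u v = position u ∷ bends u v ++ [ position v ]

  field
    position-injective : ∀ {u v} → Vertex u → Vertex v → position u ≡ position v → u ≡ v
    arc-simple : ∀ {u v R s t} → Edge u v →
                 arc u v ∋ R at s → arc u v ∋ R at t → s ≡ t
    arc-avoids-vertices : ∀ {u v w t} → Edge u v → Vertex w →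
                          arc u v ∋ position w at t → w ≡ u ⊎ w ≡ v
    arcs-cross-at-vertices : ∀ {u v u′ v′ R s t} → Edge u v → Edge u′ v′ →
                             arc u v ∋ R at s → arc u′ v′ ∋ R at t →
                             (u ≡ u′ × v ≡ v′) ⊎ (∃ λ w → Vertex w × R ≡ position w)

------------------------------------------------------------------------
-- Partitions and boundary graphs

record Partition {N} (k : ℕ) (G : Graph N) : Set₁ where
  open Graph G
  field
    part     : Fin k → Pred (Fin N) 0ℓ
    part?    : ∀ i → Decidable (part i)
    disjoint : ∀ {i j v} → part i v → part j v → i ≡ j
    union    : ∀ v → Vertex v ⇔ (∃ λ i → part i v)

  component : Fin k → Graph N
  component i = induced G (part? i)

  componentOf : ∀ {v} → Vertex v → Fin k
  componentOf {v} v∈G = proj₁ (Equivalence.to (union v) v∈G)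

  Boundary : Fin k → Pred (Fin N) 0ℓ
  Boundary i v = part i v × ∃ λ w → v ~ w × ∃ λ j → j ≢ i × part j w

  boundary? : ∀ i → Decidable (Boundary i)
  boundary? i v =
    part? i v ×-dec any? λ w → (v ~? w) ×-dec any? λ j → ¬? (j ≟ i) ×-dec part? j w

  B : Fin k → List (Fin N)
  B i = filter (boundary? i) (allFin N)

  BoundaryVertex : Pred (Fin N) 0ℓ
  BoundaryVertex v = ∃ λ i → Boundary i v

  boundaryVertex? : Decidable BoundaryVertex
  boundaryVertex? v = any? λ i → boundary? i v

  SameBoundary : Rel (Fin N) 0ℓ
  SameBoundary u v = ∃ λ i → Boundary i u × Boundary i v

  sameBoundary? : B.Decidable SameBoundary
  sameBoundary? u v = any? λ i → boundary? i u ×-dec boundary? i v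

  BG : Graph N
  BG = record
    { Vertex   = BoundaryVertex
    ; vertex?  = boundaryVertex?
    ; _~_      = λ u v → BoundaryVertex u × BoundaryVertex v × (u ~ v ⊎ (SameBoundary u v × u ≢ v))
    ; _~?_     = λ u v → boundaryVertex? u ×-dec (boundaryVertex? v ×-dec
                         ((u ~? v) ⊎-dec (sameBoundary? u v ×-dec ¬? (u ≟ v))))
    ; ~-sym    = λ (bu , bv , e) →
                   bv , bu , Sum.map ~-sym (λ ((i , x , y) , u≢v) → (i , y , x) , λ v≡u → u≢v (sym v≡u)) e
    ; ~-irrefl = λ { (_ , _ , inj₁ e) → ~-irrefl e ; (_ , _ , inj₂ (_ , v≢v)) → v≢v refl }
    ; ~-vertex = λ (bu , _) → bu
    }

------------------------------------------------------------------------
-- Computations with running time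

record Timed {a} (A : Set a) : Set a where
  constructor _taking_
  field
    value : A
    time  : ℕ

open Timed public

infixl 1 _>>=_ _>>_

return : ∀ {a} {A : Set a} → A → Timed A
return x = x taking 0

_>>=_ : ∀ {a b} {A : Set a} {B : Set b} → Timed A → (A → Timed B) → Timed B
m >>= f = value (f (value m)) taking (time m + time (f (value m)))

_>>_ : ∀ {a b} {A : Set a} {B : Set b} → Timed A → Timed B → Timed B
m >> m′ = m >>= λ _ → m′

-- Upper bounds on the O(1) times of the elementary operations.
record Costs : Set where
  field
    lookupCost addCost minCost assignCost branchCost loopCost : ℕ

-- Assigns the iterations of every parallel loop (m of them) to p processors.
record EvenSchedule (p : ℕ) .{{_ : NonZero p}} : Set where
  field
    processor : ∀ m → Fin m → Fin p
    even      : ∀ m j → card (λ i → processor m i ≟ j) ≤ ⌈ m / p ⌉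

module Loops (costs : Costs) where
  open Costs costs

  for : ∀ {a b} {A : Set a} {B : Set b} → List A → B → (A → B → Timed B) → Timed B
  for []       acc body = return acc
  for (x ∷ xs) acc body = do
    acc′ ← body x acc
    _    ← acc′ taking loopCost
    for xs acc′ body

  -- Each processor runs its own iterations one after another; the loop ends
  -- when the last processor does.
  parallelFor : ∀ {a b} {A : Set a} {B : Set b} {p} .{{_ : NonZero p}} →
                EvenSchedule p → List A → (A → Timed B) → Timed (List B)
  parallelFor {p = p} σ xs body =
    map (λ x → value (body x)) xs taking foldr _⊔_ 0 (map work (allFin p))
    where
    open EvenSchedule σ
    work : Fin p → ℕ
    work j = sum (map (λ i → time (body (lookup xs i)) + loopCost)
                      (filter (λ i → processor (length xs) i ≟ j) (allFin (length xs))))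

-- A value held in the memory of a node.
record On {a q} (x : Fin q) (A : Set a) : Set a where
  constructor on
  field contents : A

open On public

-- Data transfer between nodes is free of charge.
transfer : ∀ {a q} {A : Set a} {x y : Fin q} → On x A → Timed (On y A)
transfer (on a) = return (on a)

------------------------------------------------------------------------
-- Weights and distances

-- The laws used of ℝ, which is an instance.  Nonnegativity is required of
-- the weights of edges, not of the whole domain.
record WeightDomain c ℓ₁ ℓ₂ : Set (L.suc (c L.⊔ ℓ₁ L.⊔ ℓ₂)) where
  infixl 6 _∙_
  field
    totalOrder : TotalOrder c ℓ₁ ℓ₂
  open TotalOrder totalOrder public
    using (Carrier; isTotalOrder) renaming (_≈_ to _≈ʷ_; _≤_ to _≤ʷ_)
  field
    _∙_                 : Carrier → Carrier → Carrier
    ε                   : Carrier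
    isCommutativeMonoid : IsCommutativeMonoid _≈ʷ_ _∙_ ε
    ∙-mono-≤            : _∙_ Preserves₂ _≤ʷ_ ⟶ _≤ʷ_ ⟶ _≤ʷ_

module Weighted {c ℓ₁ ℓ₂} (D : WeightDomain c ℓ₁ ℓ₂) where
  open WeightDomain D

  Length : Set c
  Length = Carrier ⁺

  pattern ∞ = ⊤⁺

  open Supremum≈ _≈ʷ_ public using (_≈⁺_)

  lengthOrder : TotalOrder _ _ _
  lengthOrder = record { isTotalOrder = Supremum≤.≤⁺-isTotalOrder _≤ʷ_ isTotalOrder }

  open Min lengthOrder public using (_⊓_)

  infixl 6 _⊕_
  _⊕_ : Length → Length → Length
  Sup.[ x ] ⊕ Sup.[ y ] = Sup.[ x ∙ y ]
  Sup.[ x ] ⊕ ∞         = ∞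
  ∞         ⊕ y         = ∞

  record Weighting {N} (G : Graph N) : Set (c L.⊔ ℓ₁ L.⊔ ℓ₂) where
    open Graph G
    field
      weight      : Fin N → Fin N → Carrier
      symmetric   : ∀ {u v} → u ~ v → weight u v ≈ʷ weight v u
      nonnegative : ∀ {u v} → u ~ v → ε ≤ʷ weight u v

    wt : Fin N → Fin N → Length
    wt u v = Sup.[ weight u v ]

  pathLength : ∀ {N} → (Fin N → Fin N → Length) → List (Fin N) → Length
  pathLength wt (x ∷ y ∷ xs) = wt x y ⊕ pathLength wt (y ∷ xs)
  pathLength wt _            = Sup.[ ε ]

  dist : ∀ {N} → Graph N → (Fin N → Fin N → Length) → Fin N → Fin N → Length
  dist H wt u v = foldr _⊓_ ∞ (map (pathLength wt) (paths H u v))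

  module _ {N k} {G : Graph N} (w : Weighting G) (P : Partition k G) where
    open Graph G
    open Weighting w
    open Partition P

    wtBG : Fin N → Fin N → Length
    wtBG u v with sameBoundary? u v
    ... | yes (i , _) = dist (component i) wt u v
    ... | no  _       = wt u v

    -- The entries of the tables are significant only where they are
    -- constrained to be correct.
    record Tables (i : Fin k) : Set (c L.⊔ ℓ₁) where
      field
        apsp           : Fin N → Fin N → Length
        apspBG         : Fin N → Fin N → Length
        apsp-correct   : ∀ {u v} → part i u → part i v →
                         apsp u v ≈⁺ dist (component i) wt u v
        apspBG-correct : ∀ {b b′} → Boundary i b → BoundaryVertex b′ →
                         apspBG b b′ ≈⁺ dist BG wtBG b b′

    record Preprocessed : Set (c L.⊔ ℓ₁) where
      field
        {nodes} : ℕ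
        node    : Fin k → Fin nodes
        tables  : ∀ i → On (node i) (Tables i)

  module Query (costs : Costs) {p : ℕ} .{{_ : NonZero p}} (σ : EvenSchedule p)
               {N k} {G : Graph N} {w : Weighting G} {P : Partition k G}
               (pre : Preprocessed w P) where
    open Graph G
    open Partition P
    open Preprocessed pre
    open Tables
    open Costs costs
    open Loops costs

    locate : ∀ {v} → Vertex v → Timed (Fin k)
    locate v∈G = componentOf v∈G taking lookupCost

    -- A read, performed by node x, of an entry held in its own memory.
    read : ∀ {a} {A : Set a} (x : Fin nodes) → On x A → (A → Length) → Timed Length
    read x t entry = entry (contents t) taking lookupCost

    add min : Length → Length → Timed Length
    add x y = (x ⊕ y) taking addCost
    min x y = (x ⊓ y) taking (minCost + assignCost)

    set : Length → Timed Length
    set x = x taking assignCost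

    fetchColumn : (x : Fin nodes) (i : Fin k) → Fin N → Timed (On x (Fin N → Length))
    fetchColumn x i v with x ≟ node i
    ... | yes x≡y = subst (λ y → On y _) (sym x≡y) column taking branchCost
      where column = on {x = node i} λ u → apsp (contents (tables i)) u v
    ... | no  _   = do
      _ ← x taking branchCost
      transfer (on {x = node i} λ u → apsp (contents (tables i)) u v)

    query : ∀ {v₁ v₂} → Vertex v₁ → Vertex v₂ → Timed Length
    query {v₁} {v₂} v₁∈G v₂∈G = do
      C₁ ← locate v₁∈G
      C₂ ← locate v₂∈G
      let here = node C₁
          T₁   = tables C₁
      d₁ ← parallelFor σ (B C₂) λ b₂ → do
        d ← set ∞
        d ← for (B C₁) d λ b₁ d → do
          x ← read here T₁ λ t → apsp t v₁ b₁
          y ← read here T₁ λ t → apspBG t b₁ b₂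
          s ← add x y
          min d s
        return (b₂ , d)
      column ← fetchColumn here C₂ v₂
      d ← set ∞
      d ← for d₁ d λ (b₂ , d₁b₂) d → do
        x ← d₁b₂ taking lookupCost
        y ← read here column λ col → col b₂
        s ← add x y
        min d s
      _ ← C₁ taking branchCost
      if does (C₁ ≟ C₂)
        then (do
          x ← read here T₁ λ t → apsp t v₁ v₂
          min d x)
        else return d

{-# OPTIONS --safe #-}

-- A path from v₁ to v₂ either stays in one component C, and then its length
-- is at least dist_C(v₁,v₂), or it splits at its first and its last change of
-- component, whose endpoints b₁ ∈ B(C₁) and b₂ ∈ B(C₂) are boundary vertices;
-- the middle part is no shorter than dist_BG(b₁,b₂), because each of its
-- maximal pieces inside one component joins two boundary vertices.
-- Conversely, every edge of BG is at least as long as the distance in G of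
-- its ends, so that every candidate examined is at least dist(v₁,v₂).
--
-- For the running time, k² ≥ n turns |B(C)|² k ≤ c₂² n into |B(C)|⁴ ≤ c₂⁴ n.
-- As p⁴ ≥ n, each processor gets at most c₂ iterations of the parallel loop.
module Submission where

open import Defs
open import Data.Nat.Base using (ℕ; _*_; _^_; _≤_; NonZero)
open import Data.List.Base using (length)
open import Data.Product.Base using (_×_; ∃-syntax)

open import Algebra.Structures using (IsCommutativeMonoid)
open import Data.Bool.Base using (true; false; if_then_else_)
open import Data.Bool.Properties using (if-float)
open import Data.Fin.Base using (Fin; zero; suc)
open import Data.Fin.Properties using (_≟_; injective⇒≤)
open import Data.List.Base using (List; []; _∷_; map; foldl; foldr; filter; lookup; allFin)
open import Data.List.Membership.DecPropositional using (_∈?_)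
open import Data.List.Membership.Propositional using (_∈_)
open import Data.List.Membership.Propositional.Properties
  using (∈-map⁺; ∈-map⁻; ∈-filter⁺; ∈-filter⁻; ∈-allFin; ∈-cartesianProductWith⁺;
         ∈-lookup; ∈-length; foldr-selective)
open import Data.List.Properties using (foldr-preservesᵇ; length-map; map-id)
open import Data.List.Relation.Unary.All as All using ([]; _∷_)
open import Data.List.Relation.Unary.All.Properties using (¬Any⇒All¬; map⁺; tabulate⁺)
open import Data.List.Relation.Unary.AllPairs using ([]; _∷_)
open import Data.List.Relation.Unary.Any using (here; there)
open import Data.List.Relation.Unary.Linked using ([]; [-]; _∷_)
open import Data.List.Relation.Unary.Unique.Propositional using (Unique)
open import Data.Nat.Base using (zero; suc; _+_; _⊔_; z≤n; s≤s; >-nonZero; >-nonZero⁻¹)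
open import Data.Nat.DivMod using (m<n*o⇒m/o<n)
open import Data.Nat.ListAction using (sum)
import Data.Nat.Properties as ℕ
open import Data.Nat.Solver using (module +-*-Solver)
open import Data.Product.Base using (_,_; proj₁; proj₂)
open import Data.Sum.Base using (_⊎_; inj₁; inj₂)
open import Function.Bundles using (module Equivalence)
import Level as L
open import Relation.Binary.Bundles using (TotalOrder)
import Relation.Binary.Construct.Add.Supremum.Equality as Supremum≈
import Relation.Binary.Construct.Add.Supremum.NonStrict as Supremum≤
open import Relation.Binary.PropositionalEquality
  using (_≡_; _≢_; refl; sym; trans; cong; cong₂; subst)
import Relation.Binary.Reasoning.PartialOrder as PartialOrderReasoning
open import Relation.Nullary.Construct.Add.Supremum using ([_])
open import Relation.Nullary.Decidable.Core using (yes; no; does)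
open import Relation.Nullary.Negation.Core using (contradiction)

-- Completeness of the enumeration of paths

lookup-injective : ∀ {a} {A : Set a} {xs : List A} → Unique xs →
                   ∀ {i j} → lookup xs i ≡ lookup xs j → i ≡ j
lookup-injective (_ ∷ _)     {zero}  {zero}  _  = refl
lookup-injective (x∉xs ∷ _)  {zero}  {suc j} eq = contradiction eq (All.lookup x∉xs (∈-lookup j))
lookup-injective (x∉xs ∷ _)  {suc i} {zero}  eq = contradiction (sym eq) (All.lookup x∉xs (∈-lookup i))
lookup-injective (_ ∷ xs!)   {suc i} {suc j} eq = cong suc (lookup-injective xs! eq)

unique⇒length≤ : ∀ {N} {xs : List (Fin N)} → Unique xs → length xs ≤ N
unique⇒length≤ xs! = injective⇒≤ (lookup-injective xs!)

∈-sequences : ∀ {N} m {xs : List (Fin N)} → length xs ≤ m → xs ∈ sequences N m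
∈-sequences zero    {[]}     _         = here refl
∈-sequences (suc m) {[]}     _         = here refl
∈-sequences (suc m) {x ∷ xs} (s≤s ≤m) =
  there (∈-cartesianProductWith⁺ _∷_ (∈-allFin x) (∈-sequences m ≤m))

-- Makes `dist` a minimum over all paths: `sequences N N` stops at length N, and by the pigeonhole
-- principle a list of distinct vertices is no longer.
∈-paths : ∀ {N} (H : Graph N) {u v xs} → IsPath H u v xs → xs ∈ paths H u v
∈-paths {N} H {u} {v} p@(_ , _ , _ , _ , xs!) =
  ∈-filter⁺ (isPath? H u v) (∈-sequences N (unique⇒length≤ xs!)) p

-- Arithmetic of fourth powers and of linear bounds

^-cancelʳ-≤ : ∀ r {m n} .{{_ : NonZero r}} → m ^ r ≤ n ^ r → m ≤ n
^-cancelʳ-≤ r m^r≤n^r = ℕ.≮⇒≥ λ n<m → ℕ.<⇒≱ (ℕ.^-monoˡ-< r n<m) m^r≤n^r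

^-distribʳ-* : ∀ r m n → (m * n) ^ r ≡ m ^ r * n ^ r
^-distribʳ-* zero    m n = refl
^-distribʳ-* (suc r) m n = trans (cong (m * n *_) (^-distribʳ-* r m n))
  (solve 4 (λ m n x y → m :* n :* (x :* y) := m :* x :* (n :* y)) refl m n (m ^ r) (n ^ r))
  where open +-*-Solver

⌈m/p⌉≤c : ∀ {m} c p .{{_ : NonZero p}} → m ≤ c * p → ⌈ m / p ⌉ ≤ c
-- Rounding up adds p - 1, so m ≤ c p leaves the numerator strictly below (c + 1) p.
⌈m/p⌉≤c {m} c p@(suc p-1) m≤c*p = ℕ.≤-pred (m<n*o⇒m/o<n {n = suc c} {o = p} (begin-strict
  m + p-1     ≤⟨ ℕ.+-monoˡ-≤ p-1 m≤c*p ⟩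
  c * p + p-1 <⟨ ℕ.+-monoʳ-< (c * p) (ℕ.n<1+n p-1) ⟩
  c * p + p   ≡⟨ ℕ.+-comm (c * p) p ⟩
  suc c * p   ∎))
  where open ℕ.≤-Reasoning

boundary-^4 : ∀ {b k c n} .{{_ : NonZero n}} → n ≤ k ^ 2 → b ^ 2 * k ≤ c ^ 2 * n → b ^ 4 ≤ c ^ 4 * n
-- The extra factor n is there to be replaced by k², which completes the square of b² k; it is
-- cancelled afterwards, n being nonzero.
boundary-^4 {b} {k} {c} {n} n≤k² b²k≤c²n = ℕ.*-cancelʳ-≤ (b ^ 4) (c ^ 4 * n) n (begin
  b ^ 4 * n         ≤⟨ ℕ.*-monoʳ-≤ (b ^ 4) n≤k² ⟩
  b ^ 4 * k ^ 2     ≡⟨ solve 2 (λ b k → b :^ 4 :* k :^ 2 := (b :^ 2 :* k) :^ 2) refl b k ⟩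
  (b ^ 2 * k) ^ 2   ≤⟨ ℕ.^-monoˡ-≤ 2 b²k≤c²n ⟩
  (c ^ 2 * n) ^ 2   ≡⟨ solve 2 (λ c n → (c :^ 2 :* n) :^ 2 := c :^ 4 :* n :* n) refl c n ⟩
  c ^ 4 * n * n     ∎)
  where open ℕ.≤-Reasoning
        open +-*-Solver

⊔-^-≤ : ∀ r a b {x} → a ^ r ≤ x → b ^ r ≤ x → (a ⊔ b) ^ r ≤ x
⊔-^-≤ r a b {x} aʳ≤x bʳ≤x with ℕ.⊔-sel a b
... | inj₁ eq = subst (λ m → m ^ r ≤ x) (sym eq) aʳ≤x
... | inj₂ eq = subst (λ m → m ^ r ≤ x) (sym eq) bʳ≤x

-- Compared in fourth powers, b⁴ ≤ c⁴ n ≤ (c p)⁴, so that no root of n has to be formed.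
load≤ : ∀ {b c n r p} .{{_ : NonZero p}} → b ^ 4 ≤ c ^ 4 * n → n ≤ r ^ 4 → r ≤ p → ⌈ b / p ⌉ ≤ c
load≤ {b} {c} {n} {r} {p} b⁴≤c⁴n n≤r⁴ r≤p = ⌈m/p⌉≤c c p (^-cancelʳ-≤ 4 (begin
  b ^ 4         ≤⟨ b⁴≤c⁴n ⟩
  c ^ 4 * n     ≤⟨ ℕ.*-monoʳ-≤ (c ^ 4) (ℕ.≤-trans n≤r⁴ (ℕ.^-monoˡ-≤ 4 r≤p)) ⟩
  c ^ 4 * p ^ 4 ≡⟨ ^-distribʳ-* 4 c p ⟨
  (c * p) ^ 4   ∎))
  where open ℕ.≤-Reasoning

-- A record rather than an abbreviation: a and m cannot be inferred from a * m.
record AtMost (m t a : ℕ) : Set where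
  constructor atMost
  field
    bound : t ≤ a * m

open AtMost

infixr 6 _⊹_

_⊹_ : ∀ {m s t a b} → AtMost m s a → AtMost m t b → AtMost m (s + t) (a + b)
_⊹_ {m} {a = a} {b} (atMost s≤am) (atMost t≤bm) =
  atMost (ℕ.≤-trans (ℕ.+-mono-≤ s≤am t≤bm) (ℕ.≤-reflexive (sym (ℕ.*-distribʳ-+ m a b))))

constant-≤ : ∀ {m t a} .{{_ : NonZero m}} → t ≤ a → AtMost m t a
constant-≤ {m} {a = a} t≤a = atMost (ℕ.≤-trans t≤a (ℕ.m≤m*n a m))

constant : ∀ {t m} .{{_ : NonZero m}} → AtMost m t t
constant = constant-≤ ℕ.≤-refl

-- The time is linear in every m above both boundary sizes, and the fourth power of a maximum is one
-- of the fourth powers. So it suffices to bound each size separately.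
linear⇒^4 : ∀ {b₁ b₂ c n t} q .{{_ : NonZero n}} → b₁ ^ 4 ≤ c ^ 4 * n → b₂ ^ 4 ≤ c ^ 4 * n →
            (∀ {m} .{{_ : NonZero m}} → b₁ ≤ m → b₂ ≤ m → AtMost m t q) →
            t ^ 4 ≤ (q * suc c) ^ 4 * n
linear⇒^4 {b₁} {b₂} {c} {n} {t} q b₁⁴≤c⁴n b₂⁴≤c⁴n t≤q* = begin
  t ^ 4                     ≤⟨ ℕ.^-monoˡ-≤ 4 (bound (t≤q* {m} {{>-nonZero (ℕ.m≤m⊔n 1 (b₁ ⊔ b₂))}} b₁≤m b₂≤m)) ⟩
  (q * m) ^ 4               ≡⟨ ^-distribʳ-* 4 q m ⟩
  q ^ 4 * m ^ 4             ≤⟨ ℕ.*-monoʳ-≤ (q ^ 4) m⁴≤ ⟩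
  q ^ 4 * (suc c ^ 4 * n)   ≡⟨ ℕ.*-assoc (q ^ 4) (suc c ^ 4) n ⟨
  q ^ 4 * suc c ^ 4 * n     ≡⟨ cong (_* n) (^-distribʳ-* 4 q (suc c)) ⟨
  (q * suc c) ^ 4 * n       ∎
  where
  open ℕ.≤-Reasoning
  m : ℕ
  -- The 1 covers empty boundaries: constant costs are absorbed into a multiple of m only if m is
  -- nonzero.
  m = 1 ⊔ (b₁ ⊔ b₂)
  b₁≤m : b₁ ≤ m
  b₁≤m = ℕ.≤-trans (ℕ.m≤m⊔n b₁ b₂) (ℕ.m≤n⊔m 1 (b₁ ⊔ b₂))
  b₂≤m : b₂ ≤ m
  b₂≤m = ℕ.≤-trans (ℕ.m≤n⊔m b₁ b₂) (ℕ.m≤n⊔m 1 (b₁ ⊔ b₂))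
  c⁴≤ : c ^ 4 * n ≤ suc c ^ 4 * n
  c⁴≤ = ℕ.*-monoˡ-≤ n (ℕ.^-monoˡ-≤ 4 (ℕ.n≤1+n c))
  -- With c in place of `suc c` this would fail for c = 0.
  1≤ : 1 ≤ suc c ^ 4 * n
  1≤ = ℕ.*-mono-≤ (ℕ.m^n>0 (suc c) 4) (>-nonZero⁻¹ n)
  m⁴≤ : m ^ 4 ≤ suc c ^ 4 * n
  m⁴≤ = ⊔-^-≤ 4 1 (b₁ ⊔ b₂) 1≤ (⊔-^-≤ 4 b₁ b₂ (ℕ.≤-trans b₁⁴≤c⁴n c⁴≤) (ℕ.≤-trans b₂⁴≤c⁴n c⁴≤))

sum-map-≤ : ∀ {a} {A : Set a} (f : A → ℕ) {t} → (∀ x → f x ≤ t) → ∀ xs → sum (map f xs) ≤ length xs * t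
sum-map-≤ f f≤t []       = z≤n
sum-map-≤ f f≤t (x ∷ xs) = ℕ.+-mono-≤ (f≤t x) (sum-map-≤ f f≤t xs)

-- Running times of loops

module _ (costs : Costs) where
  open Costs costs
  open Loops costs

  -- Shared by the bodies of both sequential loops.
  candidateCost : ℕ
  candidateCost = lookupCost + (lookupCost + (addCost + (minCost + assignCost)))

  -- Nested as `query` unfolds, with the zeros charged by `return`, so that `_⊹_` assembles the
  -- bound with no rearrangement; c bounds the iterations per processor.
  timeFactor : ℕ → ℕ
  timeFactor c =
    lookupCost + (lookupCost +
    (c * (assignCost + (candidateCost + loopCost + 0) + loopCost) +
    (branchCost + 0 + (assignCost + (candidateCost + loopCost +
    (branchCost + (lookupCost + (minCost + assignCost))))))))

  for-time : ∀ {a b} {A : Set a} {B : Set b} {body : A → B → Timed B} {t m} →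
             (∀ x acc → time (body x acc) ≡ t) →
             ∀ xs acc → length xs ≤ m → AtMost m (time (for xs acc body)) (t + loopCost)
  for-time {body = body} {t} {m} body≡t xs acc xs≤m = atMost (begin
    time (for xs acc body)     ≡⟨ exact xs acc ⟩
    length xs * (t + loopCost) ≤⟨ ℕ.*-monoˡ-≤ (t + loopCost) xs≤m ⟩
    m * (t + loopCost)         ≡⟨ ℕ.*-comm m (t + loopCost) ⟩
    (t + loopCost) * m         ∎)
    where
    open ℕ.≤-Reasoning
    exact : ∀ xs acc → time (for xs acc body) ≡ length xs * (t + loopCost)
    exact []       acc = refl
    exact (x ∷ xs) acc = trans
      (cong₂ (λ s r → s + (loopCost + r)) (body≡t x acc) (exact xs (value (body x acc))))
      (sym (ℕ.+-assoc t loopCost (length xs * (t + loopCost))))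

  -- The loop lasts as long as its busiest processor, and `even` gives each processor at most c
  -- iterations.
  parallelFor-time : ∀ {a b} {A : Set a} {B : Set b} {p} .{{_ : NonZero p}} (σ : EvenSchedule p)
                     (xs : List A) {body : A → Timed B} {t c m} .{{_ : NonZero m}} →
                     (∀ x → AtMost m (time (body x)) t) → ⌈ length xs / p ⌉ ≤ c →
                     AtMost m (time (parallelFor σ xs body)) (c * (t + loopCost))
  parallelFor-time σ xs {t = t} {c} {m} body≤tm ⌈xs/p⌉≤c = atMost
    (foldr-preservesᵇ {P = _≤ c * (t + loopCost) * m} ℕ.⊔-lub z≤n (map⁺ (tabulate⁺ λ j →
      ℕ.≤-trans (sum-map-≤ _ (λ i → bound (body≤tm (lookup xs i) ⊹ constant {loopCost}))
                 (filter (λ i → processor (length xs) i ≟ j) (allFin (length xs))))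
      (ℕ.≤-trans (ℕ.*-monoˡ-≤ ((t + loopCost) * m) (ℕ.≤-trans (even (length xs) j) ⌈xs/p⌉≤c))
               (ℕ.≤-reflexive (sym (ℕ.*-assoc c (t + loopCost) m)))))))
    where open EvenSchedule σ

-- Lengths with infinity, and their minimum

module _ {c ℓ₁ ℓ₂} (D : WeightDomain c ℓ₁ ℓ₂) where
  open Weighted D
  open WeightDomain D using (_≈ʷ_; _≤ʷ_; ε; isCommutativeMonoid; ∙-mono-≤)
  open Supremum≈ _≈ʷ_ using ([_]; ⊤⁺≈⊤⁺)
  open Supremum≤ _≤ʷ_ using ([_]; _≤⊤⁺)
  open TotalOrder lengthOrder using (poset; total; antisym) renaming
    (_≤_ to _≤⁺_; refl to ≤⁺-refl; reflexive to ≤⁺-reflexive; trans to ≤⁺-trans; module Eq to ≈⁺)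
  open PartialOrderReasoning poset

  private
    module CM = IsCommutativeMonoid isCommutativeMonoid

  ⊕-mono : ∀ {x x′ y y′} → x ≤⁺ x′ → y ≤⁺ y′ → x ⊕ y ≤⁺ x′ ⊕ y′
  ⊕-mono [ p ]     [ q ]     = [ ∙-mono-≤ p q ]
  ⊕-mono [ _ ]     (_ ≤⊤⁺)   = _ ≤⊤⁺
  ⊕-mono (_ ≤⊤⁺)   _         = _ ≤⊤⁺

  ⊕-assoc : ∀ x y z → (x ⊕ y) ⊕ z ≈⁺ x ⊕ (y ⊕ z)
  ⊕-assoc [ x ] [ y ] [ z ] = [ CM.assoc x y z ]
  ⊕-assoc [ x ] [ y ] ∞     = ⊤⁺≈⊤⁺
  ⊕-assoc [ x ] ∞     z     = ⊤⁺≈⊤⁺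
  ⊕-assoc ∞     y     z     = ⊤⁺≈⊤⁺

  ⊕-identityˡ : ∀ x → [ ε ] ⊕ x ≈⁺ x
  ⊕-identityˡ [ x ] = [ CM.identityˡ x ]
  ⊕-identityˡ ∞     = ⊤⁺≈⊤⁺

  ⊕-identityʳ : ∀ x → x ⊕ [ ε ] ≈⁺ x
  ⊕-identityʳ [ x ] = [ CM.identityʳ x ]
  ⊕-identityʳ ∞     = ⊤⁺≈⊤⁺

  y≤x⊕y : ∀ {x} y → [ ε ] ≤⁺ x → y ≤⁺ x ⊕ y
  y≤x⊕y y ε≤x = ≤⁺-trans (≤⁺-reflexive (≈⁺.sym (⊕-identityˡ y))) (⊕-mono ε≤x ≤⁺-refl)

  -- Holds up to `≡` and not only `≈⁺`, since `_⊓_` returns one of its arguments; thus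
  -- `dist-attained` can name a path whose length is the distance itself.
  ⊓-sel : ∀ x y → x ⊓ y ≡ x ⊎ x ⊓ y ≡ y
  ⊓-sel x y with total x y
  ... | inj₁ _ = inj₁ refl
  ... | inj₂ _ = inj₂ refl

  ⊓-glb : ∀ {x y z} → z ≤⁺ x → z ≤⁺ y → z ≤⁺ x ⊓ y
  ⊓-glb {x} {y} z≤x z≤y with total x y
  ... | inj₁ _ = z≤x
  ... | inj₂ _ = z≤y

  x⊓y≤x : ∀ x y → x ⊓ y ≤⁺ x
  x⊓y≤x x y with total x y
  ... | inj₁ _   = ≤⁺-refl
  ... | inj₂ y≤x = y≤x

  x⊓y≤y : ∀ x y → x ⊓ y ≤⁺ y
  x⊓y≤y x y with total x y
  ... | inj₁ x≤y = x≤y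
  ... | inj₂ _   = ≤⁺-refl

  foldr-⊓-≤ : ∀ {x xs} → x ∈ xs → foldr _⊓_ ∞ xs ≤⁺ x
  foldr-⊓-≤ {xs = y ∷ ys} (here refl) = x⊓y≤x y (foldr _⊓_ ∞ ys)
  foldr-⊓-≤ {xs = y ∷ ys} (there x∈)  = ≤⁺-trans (x⊓y≤y y (foldr _⊓_ ∞ ys)) (foldr-⊓-≤ x∈)

  -- Distances in a single weighted graph

  module _ {N} (H : Graph N) (wt : Fin N → Fin N → Length) where
    open Graph H

    dist≤pathLength : ∀ {u v xs} → IsPath H u v xs → dist H wt u v ≤⁺ pathLength wt xs
    dist≤pathLength p = foldr-⊓-≤ (∈-map⁺ (pathLength wt) (∈-paths H p))

    -- A finite minimum is one of the entries or the initial ∞.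
    dist-attained : ∀ u v → dist H wt u v ≡ ∞ ⊎
                    ∃[ xs ] (IsPath H u v xs × dist H wt u v ≡ pathLength wt xs)
    dist-attained u v with foldr-selective ⊓-sel ∞ (map (pathLength wt) (paths H u v))
    ... | inj₁ eq = inj₁ eq
    ... | inj₂ ∈ps with ∈-map⁻ (pathLength wt) ∈ps
    ...   | xs , xs∈ , eq = inj₂ (xs , proj₂ (∈-filter⁻ (isPath? H u v) {xs = sequences N N} xs∈) , eq)

    -- Lets later arguments work with a vertex and a length alone: every nonempty suffix of a path
    -- is a path to the same end, so R propagates backwards from v.
    path-induction : ∀ {r} (R : Fin N → Length → Set r) {v} → (Vertex v → R v [ ε ]) →
                     (∀ {a b x} → a ~ b → R b x → R a (wt a b ⊕ x)) →
                     ∀ {u xs} → IsPath H u v xs → R u (pathLength wt xs)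
    path-induction R base step {xs = x ∷ []} (refl , refl , (x∈H ∷ []) , _ , _) = base x∈H
    path-induction R base step {xs = x ∷ y ∷ xs} (refl , l , (_ ∷ vs) , (e ∷ es) , (_ ∷ u)) =
      step e (path-induction R base step (refl , l , vs , es , u))

    -- A feasible potential, as in linear programming duality: f drops by at most the weight along
    -- each edge, hence by at most the length along a path. With f the distance in `G` to v, this
    -- bounds distances in components and in `BG` from below.
    potential-≤ : (f : Fin N → Length) → (∀ {a b} → a ~ b → f a ≤⁺ wt a b ⊕ f b) →
                  ∀ {v} → (Vertex v → f v ≤⁺ [ ε ]) → ∀ u → f u ≤⁺ dist H wt u v
    potential-≤ f relaxed {v} fv≤ε u with dist-attained u v
    ... | inj₁ eq          = subst (f u ≤⁺_) (sym eq) (_ ≤⊤⁺)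
    ... | inj₂ (_ , p , eq) = subst (f u ≤⁺_) (sym eq)
      (path-induction (λ a x → f a ≤⁺ x) fv≤ε
        (λ a~b fb≤x → ≤⁺-trans (relaxed a~b) (⊕-mono ≤⁺-refl fb≤x)) p)

    dist-refl : ∀ {v} → Vertex v → dist H wt v v ≤⁺ [ ε ]
    dist-refl v∈H = dist≤pathLength (refl , refl , (v∈H ∷ []) , [-] , ([] ∷ []))

    module _ (wt-nonneg : ∀ {u v} → u ~ v → [ ε ] ≤⁺ wt u v) where

      -- Cutting off a beginning removes nonnegative weights.
      path-suffix : ∀ {t u v xs} → IsPath H u v xs → t ∈ xs →
                    ∃[ ys ] (IsPath H t v ys × pathLength wt ys ≤⁺ pathLength wt xs)
      path-suffix p@(refl , _) (here refl) = _ , p , ≤⁺-refl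
      path-suffix {xs = x ∷ y ∷ xs} (refl , l , (_ ∷ vs) , (e ∷ es) , (_ ∷ u)) (there t∈)
        with path-suffix (refl , l , vs , es , u) t∈
      ... | ys , q , ≤xs = ys , q , ≤⁺-trans ≤xs (y≤x⊕y _ (wt-nonneg e))

      -- Paths repeat no vertex, so u can be put in front of a shortest path from v only if it is
      -- not on it. If it is, the suffix from u is already short enough.
      dist-relaxed : ∀ {u v} w → u ~ v → dist H wt u w ≤⁺ wt u v ⊕ dist H wt v w
      dist-relaxed {u} {v} w u~v with dist-attained v w
      ... | inj₁ eq = subst (λ d → dist H wt u w ≤⁺ wt u v ⊕ d) (sym eq) (≤⁺-trans (_ ≤⊤⁺) (x⊕∞ (wt u v)))
        where
        x⊕∞ : ∀ x → ∞ ≤⁺ x ⊕ ∞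
        x⊕∞ [ _ ] = _ ≤⊤⁺
        x⊕∞ ∞     = _ ≤⊤⁺
      ... | inj₂ (xs , p , eq) rewrite eq with _∈?_ _≟_ u xs
      dist-relaxed {u} {v} w u~v | inj₂ (xs , p , eq) | yes u∈xs with path-suffix p u∈xs
      ... | ys , q , ≤xs = ≤⁺-trans (dist≤pathLength q) (≤⁺-trans ≤xs (y≤x⊕y _ (wt-nonneg u~v)))
      dist-relaxed {u} w u~v | inj₂ (x ∷ xs , (refl , l , vs , es , !) , eq) | no u∉xs =
        dist≤pathLength (refl , l , (~-vertex u~v ∷ vs) , (u~v ∷ es) , (¬Any⇒All¬ _ u∉xs ∷ !))

      dist-nonneg : ∀ u v → [ ε ] ≤⁺ dist H wt u v
      dist-nonneg u v = potential-≤ (λ _ → [ ε ])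
        (λ a~b → ≤⁺-trans (wt-nonneg a~b) (≤⁺-reflexive (≈⁺.sym (⊕-identityʳ _)))) (λ _ → ≤⁺-refl) u

      dist-edge : ∀ {u v} → u ~ v → dist H wt u v ≤⁺ wt u v
      dist-edge u~v = ≤⁺-trans (dist-relaxed _ u~v)
        (≤⁺-trans (⊕-mono ≤⁺-refl (dist-refl (~-vertex (~-sym u~v)))) (≤⁺-reflexive (⊕-identityʳ _)))

      -- Adds the edges of a shortest path from u to v one at a time by `dist-relaxed`;
      -- concatenating two paths could repeat vertices.
      dist-triangle : ∀ u v w → dist H wt u w ≤⁺ dist H wt u v ⊕ dist H wt v w
      dist-triangle u v w with dist-attained u v
      ... | inj₁ eq           = subst (λ d → dist H wt u w ≤⁺ d ⊕ dist H wt v w) (sym eq) (_ ≤⊤⁺)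
      ... | inj₂ (_ , p , eq) = subst (λ d → dist H wt u w ≤⁺ d ⊕ dist H wt v w) (sym eq)
        (path-induction (λ a x → dist H wt a w ≤⁺ x ⊕ dist H wt v w)
          (λ _ → y≤x⊕y _ ≤⁺-refl)
          (λ a~b b≤ → ≤⁺-trans (dist-relaxed w a~b)
                        (≤⁺-trans (⊕-mono ≤⁺-refl b≤) (≤⁺-reflexive (≈⁺.sym (⊕-assoc _ _ _))))) p)

  -- Comparison of distances in `G`, its components and `BG`

  module _ {N k} {G : Graph N} (w : Weighting G) (P : Partition k G) where
    open Graph G
    open Weighting w
    open Partition P

    distG : Fin N → Fin N → Length
    distG = dist G wt

    distC : Fin k → Fin N → Fin N → Length
    distC i = dist (component i) wt

    distBG : Fin N → Fin N → Length
    distBG = dist BG (wtBG w P)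

    wt-nonneg : ∀ {u v} → u ~ v → [ ε ] ≤⁺ wt u v
    wt-nonneg e = [ nonnegative e ]

    wt-nonneg-component : ∀ i {u v} → Graph._~_ (component i) u v → [ ε ] ≤⁺ wt u v
    wt-nonneg-component i (e , _) = wt-nonneg e

    part⇒componentVertex : ∀ {i v} → part i v → Graph.Vertex (component i) v
    part⇒componentVertex {i} {v} v∈i = Equivalence.from (union v) (i , v∈i) , v∈i

    distG≤distC : ∀ i u v → distG u v ≤⁺ distC i u v
    distG≤distC i u v = potential-≤ (component i) wt (λ a → distG a v)
      (λ (e , _) → dist-relaxed G wt wt-nonneg v e)
      (λ (v∈G , _) → dist-refl G wt v∈G) u

    -- `sameBoundary?` returns some index j; disjointness of the parts makes it i.
    wtBG-sameBoundary : ∀ {i u v} → Boundary i u → Boundary i v → wtBG w P u v ≡ distC i u v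
    wtBG-sameBoundary {i} {u} {v} bu bv with sameBoundary? u v
    ... | yes (j , bu′ , _) = cong (λ l → distC l u v) (disjoint (proj₁ bu′) (proj₁ bu))
    ... | no ¬same          = contradiction (i , bu , bv) ¬same

    wtBG-crossing : ∀ {i j u v} → part i u → part j v → i ≢ j → wtBG w P u v ≡ wt u v
    wtBG-crossing {u = u} {v} u∈i v∈j i≢j with sameBoundary? u v
    ... | yes (_ , bu , bv) =
      contradiction (trans (disjoint u∈i (proj₁ bu)) (disjoint (proj₁ bv) v∈j)) i≢j
    ... | no _              = refl

    -- An edge of `G` may also join two boundary vertices of one component, and then its weight is a
    -- component distance. Hence here and in `distG≤wtBG` the answer of `sameBoundary?` takes
    -- precedence over the kind of edge.
    wtBG-nonneg : ∀ {u v} → Graph._~_ BG u v → [ ε ] ≤⁺ wtBG w P u v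
    wtBG-nonneg {u} {v} (_ , _ , e) with sameBoundary? u v | e
    ... | yes (i , _)  | _                 = dist-nonneg (component i) wt (wt-nonneg-component i) u v
    ... | no _         | inj₁ u~v          = wt-nonneg u~v
    ... | no ¬same     | inj₂ (same , _)   = contradiction same ¬same

    distG≤wtBG : ∀ {u v} → Graph._~_ BG u v → distG u v ≤⁺ wtBG w P u v
    distG≤wtBG {u} {v} (_ , _ , e) with sameBoundary? u v | e
    ... | yes (i , _)  | _                 = distG≤distC i u v
    ... | no _         | inj₁ u~v          = dist-edge G wt wt-nonneg u~v
    ... | no ¬same     | inj₂ (same , _)   = contradiction same ¬same

    -- By the triangle inequality and `distG≤wtBG`, the distance in `G` to v is a feasible potential
    -- on `BG`.
    distG≤distBG : ∀ u v → distG u v ≤⁺ distBG u v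
    distG≤distBG u v = potential-≤ BG (wtBG w P) (λ a → distG a v)
      (λ e → ≤⁺-trans (dist-triangle G wt wt-nonneg _ _ v) (⊕-mono (distG≤wtBG e) ≤⁺-refl))
      (λ (i , v∈i , _) → dist-refl G wt (Equivalence.from (union v) (i , v∈i))) u

    -- Distinct u and v are joined by an edge of `BG` of this weight. As `BG` has no loops, equal
    -- ones are settled apart, with ε between the two sides.
    distBG≤distC : ∀ {i u v} → Boundary i u → Boundary i v → distBG u v ≤⁺ distC i u v
    distBG≤distC {i} {u} {v} bu bv with u ≟ v
    ... | yes refl = ≤⁺-trans (dist-refl BG (wtBG w P) (i , bu))
                             (dist-nonneg (component i) wt (wt-nonneg-component i) u u)
    ... | no u≢v = ≤⁺-trans
      (dist-edge BG (wtBG w P) wtBG-nonneg ((i , bu) , (i , bv) , inj₂ ((i , bu , bv) , u≢v)))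
      (≤⁺-reflexive (≈⁺.reflexive (wtBG-sameBoundary bu bv)))

    -- Splitting a path at its changes of component

    crossing⇒boundary : ∀ {i j u v} → part i u → part j v → u ~ v → i ≢ j → Boundary i u
    crossing⇒boundary u∈i v∈j u~v i≢j = u∈i , _ , u~v , _ , (λ j≡i → i≢j (sym j≡i)) , v∈j

    -- Records inequalities instead of cut points, so that it can be built by `path-induction` one
    -- edge at a time; u and x come last because they are what varies along the path. The sum in
    -- `through` is a candidate of the query.
    data Route (j : Fin k) (v u : Fin N) (x : Length) : Set (c L.⊔ ℓ₁ L.⊔ ℓ₂) where
      inside  : part j u → distC j u v ≤⁺ x → Route j v u x
      through : ∀ {i b₁ b₂} → part i u → Boundary i b₁ → Boundary j b₂ →
                distC i u b₁ ⊕ (distBG b₁ b₂ ⊕ distC j b₂ v) ≤⁺ x → Route j v u x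

    extend : ∀ {j v a b x} → a ~ b → Route j v b x → Route j v a (wt a b ⊕ x)
    extend {j} {v} {a} {b} {x} a~b route with Equivalence.to (union a) (~-vertex a~b)
    extend {j} {v} {a} {b} {x} a~b (inside b∈j b→v≤x) | i , a∈i with i ≟ j
    ... | yes refl = inside a∈i (≤⁺-trans
      (dist-relaxed (component i) wt (wt-nonneg-component i) v (a~b , a∈i , b∈j))
      (⊕-mono ≤⁺-refl b→v≤x))
    -- The edge changes component, so its own ends serve as the two boundary vertices.
    ... | no i≢j = through a∈i a-boundary b-boundary (begin
      distC i a a ⊕ (distBG a b ⊕ distC j b v)
        ≤⟨ ⊕-mono (dist-refl (component i) wt (part⇒componentVertex a∈i))
             (⊕-mono (dist-edge BG (wtBG w P) wtBG-nonneg
                         ((i , a-boundary) , (j , b-boundary) , inj₁ a~b)) b→v≤x) ⟩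
      [ ε ] ⊕ (wtBG w P a b ⊕ x)  ≈⟨ ⊕-identityˡ _ ⟩
      wtBG w P a b ⊕ x            ≡⟨ cong (_⊕ x) (wtBG-crossing a∈i b∈j i≢j) ⟩
      wt a b ⊕ x                  ∎)
      where
      a-boundary = crossing⇒boundary a∈i b∈j a~b i≢j
      b-boundary = crossing⇒boundary b∈j a∈i (~-sym a~b) (λ j≡i → i≢j (sym j≡i))
    extend {j} {v} {a} {b} {x} a~b (through {l} {b₁} {b₂} b∈l b₁∈ b₂∈ b→v≤x) | i , a∈i with i ≟ l
    -- a lies in the component of b, so b₁ and b₂ stay and only the first summand changes.
    ... | yes refl = through a∈i b₁∈ b₂∈ (begin
      distC i a b₁ ⊕ rest
        ≤⟨ ⊕-mono (dist-relaxed (component i) wt (wt-nonneg-component i) b₁ (a~b , a∈i , b∈l)) ≤⁺-refl ⟩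
      (wt a b ⊕ distC i b b₁) ⊕ rest ≈⟨ ⊕-assoc (wt a b) (distC i b b₁) rest ⟩
      wt a b ⊕ (distC i b b₁ ⊕ rest) ≤⟨ ⊕-mono ≤⁺-refl b→v≤x ⟩
      wt a b ⊕ x ∎)
      where rest = distBG b₁ b₂ ⊕ distC j b₂ v
    -- Now a takes over from b₁. The old stretch from b to b₁ joins two boundary vertices of
    -- component l, so it is absorbed into the distance in `BG`.
    ... | no i≢l = through a∈i a-boundary b₂∈ (begin
      distC i a a ⊕ (distBG a b₂ ⊕ distC j b₂ v)
        ≤⟨ ⊕-mono (dist-refl (component i) wt (part⇒componentVertex a∈i)) ≤⁺-refl ⟩
      [ ε ] ⊕ (distBG a b₂ ⊕ distC j b₂ v)
        ≈⟨ ⊕-identityˡ _ ⟩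
      distBG a b₂ ⊕ distC j b₂ v
        ≤⟨ ⊕-mono (dist-relaxed BG (wtBG w P) wtBG-nonneg b₂
                       ((i , a-boundary) , (l , b-boundary) , inj₁ a~b)) ≤⁺-refl ⟩
      (wtBG w P a b ⊕ distBG b b₂) ⊕ distC j b₂ v
        ≡⟨ cong (λ y → (y ⊕ distBG b b₂) ⊕ distC j b₂ v) (wtBG-crossing a∈i b∈l i≢l) ⟩
      (wt a b ⊕ distBG b b₂) ⊕ distC j b₂ v
        ≈⟨ ⊕-assoc (wt a b) (distBG b b₂) (distC j b₂ v) ⟩
      wt a b ⊕ (distBG b b₂ ⊕ distC j b₂ v)
        ≤⟨ ⊕-mono ≤⁺-refl (⊕-mono (dist-triangle BG (wtBG w P) wtBG-nonneg b b₁ b₂) ≤⁺-refl) ⟩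
      wt a b ⊕ ((distBG b b₁ ⊕ distBG b₁ b₂) ⊕ distC j b₂ v)
        ≈⟨ ⊕-congˡ (⊕-assoc (distBG b b₁) (distBG b₁ b₂) (distC j b₂ v)) ⟩
      wt a b ⊕ (distBG b b₁ ⊕ (distBG b₁ b₂ ⊕ distC j b₂ v))
        ≤⟨ ⊕-mono ≤⁺-refl (⊕-mono (distBG≤distC b-boundary b₁∈) ≤⁺-refl) ⟩
      wt a b ⊕ (distC l b b₁ ⊕ (distBG b₁ b₂ ⊕ distC j b₂ v))
        ≤⟨ ⊕-mono ≤⁺-refl b→v≤x ⟩
      wt a b ⊕ x ∎)
      where
      a-boundary = crossing⇒boundary a∈i b∈l a~b i≢l
      b-boundary = crossing⇒boundary b∈l a∈i (~-sym a~b) (λ l≡i → i≢l (sym l≡i))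
      ⊕-congˡ : ∀ {x y z} → y ≈⁺ z → x ⊕ y ≈⁺ x ⊕ z
      ⊕-congˡ y≈z = antisym (⊕-mono ≤⁺-refl (≤⁺-reflexive y≈z))
                            (⊕-mono ≤⁺-refl (≤⁺-reflexive (≈⁺.sym y≈z)))

    route : ∀ {j u v xs} → part j v → IsPath G u v xs → Route j v u (pathLength wt xs)
    route {j} {v = v} v∈j = path-induction G wt (Route j v)
      (λ _ → inside v∈j (dist-refl (component j) wt (part⇒componentVertex v∈j))) extend

  -- The value returned by the query

  foldl-⊓-glb : ∀ {a} {A : Set a} (g : A → Length) {y} xs {acc} → y ≤⁺ acc →
                (∀ {x} → x ∈ xs → y ≤⁺ g x) → y ≤⁺ foldl (λ d x → d ⊓ g x) acc xs
  foldl-⊓-glb g []       y≤acc _   = y≤acc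
  foldl-⊓-glb g (x ∷ xs) y≤acc y≤g =
    foldl-⊓-glb g xs (⊓-glb y≤acc (y≤g (here refl))) (λ x∈ → y≤g (there x∈))

  foldl-⊓-≤-acc : ∀ {a} {A : Set a} (g : A → Length) xs acc → foldl (λ d x → d ⊓ g x) acc xs ≤⁺ acc
  foldl-⊓-≤-acc g []       acc = ≤⁺-refl
  foldl-⊓-≤-acc g (x ∷ xs) acc = ≤⁺-trans (foldl-⊓-≤-acc g xs (acc ⊓ g x)) (x⊓y≤x acc (g x))

  foldl-⊓-≤ : ∀ {a} {A : Set a} (g : A → Length) {x xs} acc → x ∈ xs →
              foldl (λ d x → d ⊓ g x) acc xs ≤⁺ g x
  foldl-⊓-≤ g {x} {_ ∷ xs} acc (here refl) =
    ≤⁺-trans (foldl-⊓-≤-acc g xs (acc ⊓ g x)) (x⊓y≤y acc (g x))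
  foldl-⊓-≤ g {xs = z ∷ _} acc (there x∈)  = foldl-⊓-≤ g (acc ⊓ g z) x∈

  module _ (costs : Costs) where
    open Costs costs
    open Loops costs

    -- `h` serves the second loop, which runs over pairs built from `B`, so that g can still be
    -- indexed by boundary vertices; the first loop takes the identity for it.
    for-value : ∀ {a b} {A : Set a} {B : Set b} {h : A → B} {body : B → Length → Timed Length}
                (g : A → Length) → (∀ x d → value (body (h x) d) ≡ d ⊓ g x) →
                ∀ xs acc → value (for (map h xs) acc body) ≡ foldl (λ d x → d ⊓ g x) acc xs
    for-value g body≡g []       acc = refl
    for-value g body≡g (x ∷ xs) acc rewrite body≡g x acc = for-value g body≡g xs (acc ⊓ g x)

    module _ {p : ℕ} .{{_ : NonZero p}} (σ : EvenSchedule p)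
             {N k} {G : Graph N} {w : Weighting G} {P : Partition k G} (pre : Preprocessed w P) where
      open Graph G
      open Weighting w
      open Partition P
      open Preprocessed pre
      open Tables
      open Query costs σ pre

      table : ∀ i → Tables w P i
      table i = contents (tables i)

      fetchColumn-value : ∀ x i v u → contents (value (fetchColumn x i v)) u ≡ apsp (table i) u v
      fetchColumn-value x i v u with x ≟ node i
      ... | yes refl = refl
      ... | no _     = refl

      fetchColumn-time : ∀ x i v → time (fetchColumn x i v) ≤ branchCost + 0
      fetchColumn-time x i v with x ≟ node i
      ... | yes refl = ℕ.m≤m+n branchCost 0
      ... | no _     = ℕ.≤-refl

      -- `tryFirst`, `reach` and `trySecond` give names to the loop bodies of `query`, with which
      -- they agree by unfolding.
      tryFirst : Fin k → (u b₂ b₁ : Fin N) → Length → Timed Length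
      tryFirst i u b₂ b₁ d = do
        x ← read (node i) (tables i) λ t → apsp t u b₁
        y ← read (node i) (tables i) λ t → apspBG t b₁ b₂
        s ← add x y
        min d s

      reach : Fin k → (u b₂ : Fin N) → Timed (Fin N × Length)
      reach i u b₂ = do
        d ← set ∞
        d ← for (B i) d (tryFirst i u b₂)
        return (b₂ , d)

      trySecond : (x : Fin nodes) → On x (Fin N → Length) → Fin N × Length → Length → Timed Length
      trySecond x column (b₂ , e) d = do
        e ← e taking lookupCost
        y ← read x column λ col → col b₂
        s ← add e y
        min d s

      firstCandidate : Fin k → (u b₂ b₁ : Fin N) → Length
      firstCandidate i u b₂ b₁ = apsp (table i) u b₁ ⊕ apspBG (table i) b₁ b₂

      toBoundary : Fin k → (u b₂ : Fin N) → Length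
      toBoundary i u b₂ = foldl (λ d b₁ → d ⊓ firstCandidate i u b₂ b₁) ∞ (B i)

      candidate : (i j : Fin k) → (u v b₂ : Fin N) → Length
      candidate i j u v b₂ = toBoundary i u b₂ ⊕ apsp (table j) b₂ v

      viaBoundaries : (i j : Fin k) → (u v : Fin N) → Length
      viaBoundaries i j u v = foldl (λ d b₂ → d ⊓ candidate i j u v b₂) ∞ (B j)

      answer : (i j : Fin k) → (u v : Fin N) → Length
      answer i j u v = if does (i ≟ j)
        then viaBoundaries i j u v ⊓ apsp (table i) u v
        else viaBoundaries i j u v

      query-value : ∀ {v₁ v₂} (v₁∈G : Vertex v₁) (v₂∈G : Vertex v₂) →
                    value (query v₁∈G v₂∈G) ≡ answer (componentOf v₁∈G) (componentOf v₂∈G) v₁ v₂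
      -- `if-float` carries `value` into the two branches, both of which start from the result of
      -- the second loop.
      query-value {v₁} {v₂} v₁∈G v₂∈G = trans (if-float value (does (C₁ ≟ C₂)))
        (cong (λ d → if does (C₁ ≟ C₂) then d ⊓ apsp (table C₁) v₁ v₂ else d)
          (for-value (candidate C₁ C₂ v₁ v₂)
            (λ b₂ d → cong (d ⊓_) (cong₂ _⊕_ (inner b₂) (fetchColumn-value (node C₁) C₂ v₂ b₂)))
            (B C₂) ∞))
        where
        C₁ = componentOf v₁∈G
        C₂ = componentOf v₂∈G
        inner : ∀ b₂ → value (for (B C₁) ∞ (tryFirst C₁ v₁ b₂)) ≡ toBoundary C₁ v₁ b₂
        inner b₂ = trans
          (cong (λ bs → value (for bs ∞ (tryFirst C₁ v₁ b₂))) (sym (map-id (B C₁))))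
          (for-value (firstCandidate C₁ v₁ b₂) (λ _ _ → refl) (B C₁) ∞)

      ∈B⇒boundary : ∀ {i b} → b ∈ B i → Boundary i b
      ∈B⇒boundary {i} b∈ = proj₂ (∈-filter⁻ (boundary? i) {xs = allFin N} b∈)

      boundary⇒∈B : ∀ {i b} → Boundary i b → b ∈ B i
      boundary⇒∈B {i} {b} = ∈-filter⁺ (boundary? i) (∈-allFin b)

      distG≤apsp : ∀ {i u v} → part i u → part i v → distG w P u v ≤⁺ apsp (table i) u v
      distG≤apsp {i} {u} {v} u∈i v∈i = ≤⁺-trans (distG≤distC w P i u v)
        (≤⁺-reflexive (≈⁺.sym (apsp-correct (table i) u∈i v∈i)))

      -- The triangle inequality at b₂ and then at b₁: each of the three summands of a candidate
      -- dominates a distance in `G`, as does the initial ∞.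
      distG≤viaBoundaries : ∀ {i j u v} → part i u → part j v → distG w P u v ≤⁺ viaBoundaries i j u v
      distG≤viaBoundaries {i} {j} {u} {v} u∈i v∈j = foldl-⊓-glb (candidate i j u v) (B j) (_ ≤⊤⁺) λ {b₂} b₂∈ →
        ≤⁺-trans (dist-triangle G wt (wt-nonneg w P) u b₂ v)
          (⊕-mono (distG≤toBoundary (∈B⇒boundary b₂∈)) (distG≤apsp (proj₁ (∈B⇒boundary b₂∈)) v∈j))
        where
        distG≤toBoundary : ∀ {b₂} → Boundary j b₂ → distG w P u b₂ ≤⁺ toBoundary i u b₂
        distG≤toBoundary {b₂} b₂∈ = foldl-⊓-glb (firstCandidate i u b₂) (B i) (_ ≤⊤⁺) λ {b₁} b₁∈ →
          ≤⁺-trans (dist-triangle G wt (wt-nonneg w P) u b₁ b₂)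
            (⊕-mono (distG≤apsp u∈i (proj₁ (∈B⇒boundary b₁∈)))
              (≤⁺-trans (distG≤distBG w P b₁ b₂)
                (≤⁺-reflexive (≈⁺.sym (apspBG-correct (table i) (∈B⇒boundary b₁∈) (j , b₂∈))))))

      distG≤answer : ∀ {i j u v} → part i u → part j v → distG w P u v ≤⁺ answer i j u v
      distG≤answer {i} {j} u∈i v∈j with i ≟ j
      ... | yes refl = ⊓-glb (distG≤viaBoundaries u∈i v∈j) (distG≤apsp u∈i v∈j)
      ... | no _     = distG≤viaBoundaries u∈i v∈j

      viaBoundaries≤ : ∀ {i j u v b₁ b₂} → part i u → part j v → Boundary i b₁ → Boundary j b₂ →
        viaBoundaries i j u v ≤⁺ distC w P i u b₁ ⊕ (distBG w P b₁ b₂ ⊕ distC w P j b₂ v)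
      viaBoundaries≤ {i} {j} {u} {v} {b₁} {b₂} u∈i v∈j b₁∈ b₂∈ = begin
        viaBoundaries i j u v
          ≤⟨ foldl-⊓-≤ (candidate i j u v) ∞ (boundary⇒∈B b₂∈) ⟩
        toBoundary i u b₂ ⊕ apsp (table j) b₂ v
          ≤⟨ ⊕-mono (foldl-⊓-≤ (firstCandidate i u b₂) ∞ (boundary⇒∈B b₁∈)) ≤⁺-refl ⟩
        (apsp (table i) u b₁ ⊕ apspBG (table i) b₁ b₂) ⊕ apsp (table j) b₂ v
          ≤⟨ ⊕-mono (⊕-mono (≤⁺-reflexive (apsp-correct (table i) u∈i (proj₁ b₁∈)))
                            (≤⁺-reflexive (apspBG-correct (table i) b₁∈ (j , b₂∈))))
                    (≤⁺-reflexive (apsp-correct (table j) (proj₁ b₂∈) v∈j)) ⟩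
        (distC w P i u b₁ ⊕ distBG w P b₁ b₂) ⊕ distC w P j b₂ v
          ≈⟨ ⊕-assoc (distC w P i u b₁) (distBG w P b₁ b₂) (distC w P j b₂ v) ⟩
        distC w P i u b₁ ⊕ (distBG w P b₁ b₂ ⊕ distC w P j b₂ v) ∎

      answer≤viaBoundaries : ∀ i j u v → answer i j u v ≤⁺ viaBoundaries i j u v
      answer≤viaBoundaries i j u v with i ≟ j
      ... | yes _ = x⊓y≤x (viaBoundaries i j u v) (apsp (table i) u v)
      ... | no _  = ≤⁺-refl

      answer≤apsp : ∀ i u v → answer i i u v ≤⁺ apsp (table i) u v
      answer≤apsp i u v with i ≟ i
      ... | yes _  = x⊓y≤y (viaBoundaries i i u v) (apsp (table i) u v)
      ... | no i≢i = contradiction refl i≢i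

      -- `inside` is met by the final comparison with the table of the common component, `through`
      -- by the candidate for its two boundary vertices. Disjointness identifies the component named
      -- in the route with that of u.
      answer≤route : ∀ {i j u v x} → part i u → part j v → Route w P j v u x → answer i j u v ≤⁺ x
      answer≤route {i} {j} {u} {v} u∈i v∈j (inside u∈j ≤x) with refl ← disjoint u∈i u∈j =
        ≤⁺-trans (answer≤apsp i u v) (≤⁺-trans (≤⁺-reflexive (apsp-correct (table i) u∈i v∈j)) ≤x)
      answer≤route {i} {j} {u} {v} u∈i v∈j (through u∈l b₁∈ b₂∈ ≤x) with refl ← disjoint u∈i u∈l =
        ≤⁺-trans (answer≤viaBoundaries i j u v) (≤⁺-trans (viaBoundaries≤ u∈i v∈j b₁∈ b₂∈) ≤x)

      answer≤distG : ∀ {i j u v} → part i u → part j v → answer i j u v ≤⁺ distG w P u v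
      answer≤distG {u = u} {v} u∈i v∈j with dist-attained G wt u v
      ... | inj₁ eq           = subst (_ ≤⁺_) (sym eq) (_ ≤⊤⁺)
      ... | inj₂ (_ , π , eq) = subst (_ ≤⁺_) (sym eq) (answer≤route u∈i v∈j (route w P v∈j π))

      query-correct : ∀ {v₁ v₂} (v₁∈G : Vertex v₁) (v₂∈G : Vertex v₂) →
                      value (query v₁∈G v₂∈G) ≈⁺ dist G wt v₁ v₂
      query-correct {v₁} {v₂} v₁∈G v₂∈G = ≈⁺.trans (≈⁺.reflexive (query-value v₁∈G v₂∈G))
        (antisym (answer≤distG v₁∈C₁ v₂∈C₂) (distG≤answer v₁∈C₁ v₂∈C₂))
        where
        v₁∈C₁ = proj₂ (Equivalence.to (union v₁) v₁∈G)
        v₂∈C₂ = proj₂ (Equivalence.to (union v₂) v₂∈G)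

      -- The running time of the query

      query-time : ∀ {c m} .{{_ : NonZero m}} {v₁ v₂} (v₁∈G : Vertex v₁) (v₂∈G : Vertex v₂) →
                   length (B (componentOf v₁∈G)) ≤ m → length (B (componentOf v₂∈G)) ≤ m →
                   ⌈ length (B (componentOf v₂∈G)) / p ⌉ ≤ c →
                   AtMost m (time (query v₁∈G v₂∈G)) (timeFactor costs c)
      query-time {c} {m} {v₁} {v₂} v₁∈G v₂∈G B₁≤m B₂≤m ⌈B₂/p⌉≤c =
        -- The summands follow the statements of `query` in order; the last bounds the conditional
        -- by its costlier branch.
        constant {lookupCost} ⊹ constant {lookupCost} ⊹ parallel ⊹
        constant-≤ (fetchColumn-time (node C₁) C₂ v₂) ⊹ constant {assignCost} ⊹ sequential ⊹
        constant {branchCost} ⊹ constant-≤ (if-time (does (C₁ ≟ C₂)) ℕ.≤-refl)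
        where
        C₁ = componentOf v₁∈G
        C₂ = componentOf v₂∈G

        parallel : AtMost m (time (parallelFor σ (B C₂) (reach C₁ v₁)))
                            (c * (assignCost + (candidateCost costs + loopCost + 0) + loopCost))
        parallel = parallelFor-time costs σ (B C₂) {body = reach C₁ v₁}
          (λ b₂ → constant {assignCost} ⊹
            for-time costs {body = tryFirst C₁ v₁ b₂} (λ _ _ → refl) (B C₁) ∞ B₁≤m ⊹ constant {0})
          ⌈B₂/p⌉≤c

        column : On (node C₁) (Fin N → Length)
        column = value (fetchColumn (node C₁) C₂ v₂)

        d₁ : List (Fin N × Length)
        d₁ = map (λ b₂ → value (reach C₁ v₁ b₂)) (B C₂)

        sequential : AtMost m (time (for d₁ ∞ (trySecond (node C₁) column)))
                              (candidateCost costs + loopCost)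
        sequential = for-time costs {body = trySecond (node C₁) column} (λ _ _ → refl) d₁ ∞
          (subst (_≤ m) (sym (length-map (λ b₂ → value (reach C₁ v₁ b₂)) (B C₂))) B₂≤m)

        if-time : ∀ b {s : Timed Length} {d t} → time s ≤ t → time (if b then s else return d) ≤ t
        if-time true  s≤t = s≤t
        if-time false _   = z≤n

      -- Fourth powers express t ≤ K n^(1/4) without roots. A load of at most c makes the time
      -- linear in the boundary sizes, whose fourth powers are at most c⁴ n.
      query-time-^4 : ∀ {c r v₁ v₂} (v₁∈G : Vertex v₁) (v₂∈G : Vertex v₂) → order ≤ k ^ 2 →
                      (∀ i → length (B i) ^ 2 * k ≤ c ^ 2 * order) → order ≤ r ^ 4 → r ≤ p →
                      time (query v₁∈G v₂∈G) ^ 4 ≤ (timeFactor costs c * suc c) ^ 4 * order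
      query-time-^4 {c} {v₁ = v₁} v₁∈G v₂∈G n≤k² |B|²k≤c²n n≤r⁴ r≤p =
        linear⇒^4 (timeFactor costs c) (|B|⁴≤ _) (|B|⁴≤ _)
          λ B₁≤m B₂≤m → query-time v₁∈G v₂∈G B₁≤m B₂≤m (load≤ {c = c} (|B|⁴≤ _) n≤r⁴ r≤p)
        where
        instance
          -- v₁ itself is a vertex; this permits cancelling n in `boundary-^4`.
          order≢0 : NonZero order
          order≢0 = >-nonZero (∈-length (∈-filter⁺ vertex? (∈-allFin v₁) v₁∈G))

        |B|⁴≤ : ∀ i → length (B i) ^ 4 ≤ c ^ 4 * order
        |B|⁴≤ i = boundary-^4 {length (B i)} {k} {c} n≤k² (|B|²k≤c²n i)

lemma3 : ∀ {c ℓ₁ ℓ₂} (costs : Costs) (Δ c₁ c₂ : ℕ) → ∃[ K ]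
    ((D : WeightDomain c ℓ₁ ℓ₂) → let open Weighted D in
    ∀ {N} (G : Graph N) (w : Weighting G) → let open Graph G in
    Planar G →
    (∀ v → Vertex v → degree v ≤ Δ) →
    ∀ k → IsCeilRoot 2 order k →
    (P : Partition k G) → let open Partition P in
    (∀ i → Graph.order (component i) * k ≤ c₁ * order) →
    (∀ i → length (B i) ^ 2 * k ≤ c₂ ^ 2 * order) →
    (pre : Preprocessed w P) →
    ∀ r → IsCeilRoot 4 order r →
    ∀ p .{{_ : NonZero p}} → r ≤ p →
    (σ : EvenSchedule p) →
    ∀ {v₁ v₂} (v₁∈G : Vertex v₁) (v₂∈G : Vertex v₂) →
    let open Query costs σ pre in
    value (query v₁∈G v₂∈G) ≈⁺ dist G (Weighting.wt w) v₁ v₂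
    × time (query v₁∈G v₂∈G) ^ 4 ≤ K ^ 4 * order)
-- Fixed before the graph is given: `timeFactor` at load c₂, times the `suc c₂` of `linear⇒^4`.
lemma3 costs Δ c₁ c₂ = timeFactor costs c₂ * suc c₂ ,
  λ D G w _ _ k (n≤k² , _) P _ |B|²k≤c₂²n pre r (n≤r⁴ , _) p {{_}} r≤p σ v₁∈G v₂∈G →
    query-correct D costs σ pre v₁∈G v₂∈G ,
    query-time-^4 D costs σ pre v₁∈G v₂∈G n≤k² |B|²k≤c₂²n n≤r⁴ r≤p
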